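{- Let $z$ be an integer with $z>2$. For every integer $t\ge 0$, the average degree $\langle k_t\rangle$ of the graph $G_t^z$ satisfies $$\langle k_t\rangle=\frac{4}{3}(1-z)\left(\frac{z-1}{z}\right)^{t}+\frac{4z+2}{3},$$ and consequently $\langle k_t\rangle\to\frac{4z+2}{3}$ as $t\to\infty$.
   Context: Fix an integer $z>2$. The finite simple graphs $G_t^z$ ($t=0,1,2,\dots$), each with a distinguished vertex called its root (its largest, original hub node) and a distinguished set of vertices called its last-layer bottom nodes, are defined recursively. $G_0^z$ is a triangle; one of its vertices is the root (hub node) and the other two are its (last-layer) bottom nodes. For $t\ge1$, $G_t^z$ is formed from the disjoint union of $z$ copies of $G_{t-1}^z$, one called the original and the other $z-1$ called replicas, by adding an edge from the root of the original copy to every last-layer bottom node of each of the $z-1$ replicas. The root of $G_t^z$ is the root of the original copy, and the last-layer bottom nodes of $G_t^z$ are the last-layer bottom nodes of all $z-1$ replicas. The average degree $\langle k_t\rangle$ is the arithmetic mean of the degrees of all vertices of $G_t^z$. -}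

module Defs where

open import Algebra.Properties.CommutativeMonoid.Sum using (sum)
open import Data.Empty using (⊥)
open import Data.Fin using (Fin; zero; fromℕ<; remQuot; combine)
open import Data.Fin.Properties using (_≟_; nonZeroIndex)
open import Data.Fin.Subset using (Subset; ∣_∣)
open import Data.Integer using (+_)
open import Data.Nat using (ℕ; zero; suc; NonZero; _≥_; >-nonZero⁻¹)
                     renaming (_*_ to _*ℕ_)
open import Data.Nat.Properties using (+-0-commutativeMonoid)
open import Data.Product using (_×_; _,_; ∃-syntax)
open import Data.Rational using (ℚ; 0ℚ; _/_; _-_; _<_) renaming (∣_∣ to abs)
open import Data.Sum using (_⊎_; inj₁; inj₂)
open import Data.Vec using (tabulate)
open import Function using (_∘_)
open import Level using (0ℓ)
open import Relation.Binary using (Rel; Symmetric; Irreflexive; Decidable)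
open import Relation.Binary.PropositionalEquality
  using (_≡_; _≢_; refl; sym; ≢-sym)
open import Relation.Nullary using (does; ¬?; _×-dec_; _⊎-dec_)
import Relation.Unary as U

record SimpleGraph : Set₁ where
  field
    order    : ℕ
    _~_      : Rel (Fin order) 0ℓ
    ~-sym    : Symmetric _~_
    ~-irrefl : Irreflexive _≡_ _~_
    _~?_     : Decidable _~_

  neighbours : Fin order → Subset order
  neighbours v = tabulate (λ w → does (v ~? w))

  degree : Fin order → ℕ
  degree v = ∣ neighbours v ∣

  averageDegree : .{{_ : NonZero order}} → ℚ
  averageDegree = + (sum +-0-commutativeMonoid degree) / order

record HubGraph : Set₁ where
  field
    graph : SimpleGraph
  open SimpleGraph graph public hiding (averageDegree)
  field
    root    : Fin order
    Bottom  : U.Pred (Fin order) 0ℓ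
    Bottom? : U.Decidable Bottom

  averageDegree : ℚ
  averageDegree = SimpleGraph.averageDegree graph {{nonZeroIndex root}}

triangle : HubGraph
triangle = record
  { graph = record
    { order    = 3
    ; _~_      = _≢_
    ; ~-sym    = ≢-sym
    ; ~-irrefl = λ x≡y x≢y → x≢y x≡y
    ; _~?_     = λ x y → ¬? (x ≟ y)
    }
  ; root    = zero
  ; Bottom  = _≢ zero
  ; Bottom? = λ x → ¬? (x ≟ zero)
  }

-- `remQuot` identifies the vertices Fin (z * order) of the disjoint union
-- with pairs (copy, vertex of that copy); copy 0 is the original and the
-- other z - 1 copies are the replicas.
module Join (z : ℕ) .{{_ : NonZero z}} (H : HubGraph) where
  open HubGraph H

  Vertex : Set
  Vertex = Fin z × Fin order

  original : Fin z
  original = fromℕ< (>-nonZero⁻¹ z)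

  SameCopy : Rel Vertex 0ℓ
  SameCopy (i , u) (j , v) = i ≡ j × u ~ v

  BottomOfReplica : U.Pred Vertex 0ℓ
  BottomOfReplica (j , v) = j ≢ original × Bottom v

  HubToBottom : Rel Vertex 0ℓ
  HubToBottom (i , u) q = (i ≡ original × u ≡ root) × BottomOfReplica q

  Adjacent : Rel Vertex 0ℓ
  Adjacent p q = SameCopy p q ⊎ (HubToBottom p q ⊎ HubToBottom q p)

  adjacent-sym : Symmetric Adjacent
  adjacent-sym (inj₁ (i≡j , u~v)) = inj₁ (sym i≡j , ~-sym u~v)
  adjacent-sym (inj₂ (inj₁ h))    = inj₂ (inj₂ h)
  adjacent-sym (inj₂ (inj₂ h))    = inj₂ (inj₁ h)

  hub-irrefl : ∀ p → HubToBottom p p → ⊥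
  hub-irrefl _ ((i≡o , _) , (i≢o , _)) = i≢o i≡o

  adjacent-irrefl : Irreflexive _≡_ Adjacent
  adjacent-irrefl     refl (inj₁ (_ , u~u)) = ~-irrefl refl u~u
  adjacent-irrefl {p} refl (inj₂ (inj₁ h))  = hub-irrefl p h
  adjacent-irrefl {p} refl (inj₂ (inj₂ h))  = hub-irrefl p h

  sameCopy? : Decidable SameCopy
  sameCopy? (i , u) (j , v) = (i ≟ j) ×-dec (u ~? v)

  bottomOfReplica? : U.Decidable BottomOfReplica
  bottomOfReplica? (j , v) = ¬? (j ≟ original) ×-dec Bottom? v

  hubToBottom? : Decidable HubToBottom
  hubToBottom? (i , u) q =
    ((i ≟ original) ×-dec (u ≟ root)) ×-dec bottomOfReplica? q

  adjacent? : Decidable Adjacent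
  adjacent? p q = sameCopy? p q ⊎-dec (hubToBottom? p q ⊎-dec hubToBottom? q p)

  vertex : Fin (z *ℕ order) → Vertex
  vertex = remQuot order

  join : HubGraph
  join = record
    { graph = record
      { order    = z *ℕ order
      ; _~_      = λ x y → Adjacent (vertex x) (vertex y)
      ; ~-sym    = adjacent-sym
      ; ~-irrefl = λ { refl → adjacent-irrefl refl }
      ; _~?_     = λ x y → adjacent? (vertex x) (vertex y)
      }
    ; root    = combine original root
    ; Bottom  = BottomOfReplica ∘ vertex
    ; Bottom? = bottomOfReplica? ∘ vertex
    }

G : (z : ℕ) .{{_ : NonZero z}} → ℕ → HubGraph
G z zero    = triangle
G z (suc t) = Join.join z (G z t)

infix 4 _⟶_

_⟶_ : (ℕ → ℚ) → ℚ → Set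
a ⟶ L = ∀ (ε : ℚ) → 0ℚ < ε → ∃[ N ] (∀ n → n ≥ N → abs (a n - L) < ε)

{-# OPTIONS --safe #-}
module Submission where

-- Write m = z − 1. The last-layer bottoms number B(t) = 2 mᵗ, and each of them is
-- joined to the root by one new edge, so the degree sum satisfies
-- S(t+1) = z S(t) + 2 B(t+1). With z = m + 1 this gives
-- S(t) + 4 mᵗ⁺¹ = (4z + 2) zᵗ, and the order is 3 zᵗ.
-- The distance to the limit is thus (4/3) m (m/z)ᵗ, and the Bernoulli-type bound
-- (m/z)ᵗ ≤ m/(m + t) makes it vanish.

open import Defs
open import Data.Rational using (ℚ; 1ℚ; _/_; _+_; _*_; _-_; +-*-rawSemiring)
open import Algebra.Definitions.RawSemiring +-*-rawSemiring using (_^_)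
open import Data.Integer as ℤ using (+_)
open import Data.Nat using (ℕ; NonZero) renaming (_>_ to _>ℕ_; _+_ to _+ℕ_; _*_ to _*ℕ_)
open import Data.Product using (_×_)
open import Relation.Binary.PropositionalEquality using (_≡_)

import Algebra.Properties.Semiring.Sum as SemiringSum
open import Data.Bool using (Bool; true; false; if_then_else_)
open import Data.Fin using (Fin; zero; suc; remQuot; combine; _↑ˡ_; _↑ʳ_)
open import Data.Fin.Properties using (_≟_; remQuot-combine; nonZeroIndex)
open import Data.Fin.Subset using (∣_∣)
import Data.Integer.Properties as ℤP
open import Data.Nat as ℕ using (suc)
import Data.Nat.Properties as ℕP
open import Data.Nat.Tactic.RingSolver using (solve-∀)
open import Data.Product using (_,_; proj₁; proj₂; ∃-syntax)
open import Data.Rational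
  using (mkℚ; -_; _≤_; _<_; NonNegative; Positive; positive; toℚᵘ; fromℚᵘ; ↥_; ↧ₙ_)
  renaming (∣_∣ to abs)
import Data.Rational.Properties as ℚP
import Data.Rational.Solver as ℚ-Solver
import Data.Rational.Unnormalised as ℚᵘ
import Data.Rational.Unnormalised.Properties as ℚᵘP
open import Data.Sum using (inj₁; inj₂)
open import Data.Vec using (tabulate)
open import Function using (_∘_; mk⇔)
open import Relation.Binary.PropositionalEquality
  using (refl; sym; trans; cong; cong₂; subst; subst₂; module ≡-Reasoning)
open import Relation.Nullary using (Dec; does; yes; no; ¬_; ¬?; _×-dec_; _⊎-dec_)
open import Relation.Nullary.Decidable using (does-⇔)
open import Relation.Nullary.Negation using (contradiction)

open SemiringSum ℕP.+-*-semiring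
  using ( sum; sum-cong-≗; sum-replicate-zero; sum-syntax; ∑-distrib-+; ∑-comm
        ; *-distribˡ-sum; *-distribʳ-sum)

-- Counting by sums of indicators over `Fin`.

𝟙 : ∀ {p} {P : Set p} → Dec P → ℕ
𝟙 P? = if does P? then 1 else 0

𝟙-× : ∀ {p q} {P : Set p} {Q : Set q} (P? : Dec P) (Q? : Dec Q) →
      𝟙 (P? ×-dec Q?) ≡ 𝟙 P? *ℕ 𝟙 Q?
𝟙-× (yes _) Q? = sym (ℕP.+-identityʳ (𝟙 Q?))
𝟙-× (no _)  Q? = refl

𝟙-⊎ : ∀ {p q} {P : Set p} {Q : Set q} (P? : Dec P) (Q? : Dec Q) →
      (P → ¬ Q) → 𝟙 (P? ⊎-dec Q?) ≡ 𝟙 P? +ℕ 𝟙 Q?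
𝟙-⊎ (yes p) (yes q) P⇒¬Q = contradiction q (P⇒¬Q p)
𝟙-⊎ (yes _) (no _)  _    = refl
𝟙-⊎ (no _)  Q?      _    = refl

𝟙-¬ : ∀ {p} {P : Set p} (P? : Dec P) → 𝟙 (¬? P?) +ℕ 𝟙 P? ≡ 1
𝟙-¬ (yes _) = refl
𝟙-¬ (no _)  = refl

-- The summand is spelled out so that, for `f` of the form `does ∘ P?`, it is `𝟙` by definition;
-- degrees thereby become sums of indicators.
∣tabulate∣ : ∀ {n} (f : Fin n → Bool) →
             ∣ tabulate f ∣ ≡ ∑[ i < n ] (if f i then 1 else 0)
∣tabulate∣ {ℕ.zero} f = refl
∣tabulate∣ {suc n} f with f zero
... | true  = cong suc (∣tabulate∣ (f ∘ suc))
... | false = ∣tabulate∣ (f ∘ suc)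

sum-const : ∀ n x → ∑[ _ < n ] x ≡ n *ℕ x
sum-const ℕ.zero  x = refl
sum-const (suc n) x = cong (x +ℕ_) (sum-const n x)

sum-++ : ∀ m {n} (f : Fin (m +ℕ n) → ℕ) →
         sum f ≡ ∑[ i < m ] f (i ↑ˡ n) +ℕ ∑[ j < n ] f (m ↑ʳ j)
sum-++ ℕ.zero  f = refl
sum-++ (suc m) f =
  trans (cong (f zero +ℕ_) (sum-++ m (f ∘ suc))) (sym (ℕP.+-assoc (f zero) _ _))

sum-combine : ∀ m {n} (f : Fin (m *ℕ n) → ℕ) →
              sum f ≡ ∑[ i < m ] ∑[ j < n ] f (combine i j)
sum-combine ℕ.zero      f = refl
sum-combine (suc m) {n} f =
  trans (sum-++ n f) (cong (sum (f ∘ (_↑ˡ (m *ℕ n))) +ℕ_) (sum-combine m (f ∘ (n ↑ʳ_))))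

-- After reindexing by `combine` this is distributivity. It turns every count over the vertices of a
-- join into a count over copies times a count inside one copy.
sum-remQuot-* : ∀ m {n} (f : Fin m → ℕ) (g : Fin n → ℕ) →
                ∑[ x < m *ℕ n ] (f (proj₁ (remQuot {m} n x)) *ℕ g (proj₂ (remQuot {m} n x)))
                ≡ sum f *ℕ sum g
sum-remQuot-* m {n} f g = begin
  ∑[ x < m *ℕ n ] h (remQuot n x)
    ≡⟨ sum-combine m (h ∘ remQuot n) ⟩
  ∑[ i < m ] ∑[ j < n ] h (remQuot n (combine i j))
    ≡⟨ sum-cong-≗ {m} (λ i → sum-cong-≗ {n} (λ j → cong h (remQuot-combine i j))) ⟩
  ∑[ i < m ] ∑[ j < n ] (f i *ℕ g j)
    ≡⟨ sum-cong-≗ {m} (λ i → *-distribˡ-sum (f i) g) ⟨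
  ∑[ i < m ] (f i *ℕ sum g)
    ≡⟨ *-distribʳ-sum (sum g) f ⟨
  sum f *ℕ sum g ∎
  where
  open ≡-Reasoning
  h : Fin m × Fin n → ℕ
  h (i , j) = f i *ℕ g j

∑-𝟙-≟ˡ : ∀ {n} (i : Fin n) → ∑[ j < n ] 𝟙 (i ≟ j) ≡ 1
∑-𝟙-≟ˡ {suc n} zero    = cong suc (sum-replicate-zero n)
-- The term at `zero` vanishes, and `does (suc i ≟ suc j)` reduces to `does (i ≟ j)`, so the
-- induction hypothesis is already the goal.
∑-𝟙-≟ˡ {suc n} (suc i) = ∑-𝟙-≟ˡ i

∑-𝟙-≟ʳ : ∀ {n} (i : Fin n) → ∑[ j < n ] 𝟙 (j ≟ i) ≡ 1
∑-𝟙-≟ʳ {n} i = trans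
  (sum-cong-≗ {n} (λ j → cong (λ b → if b then 1 else 0) (does-⇔ (mk⇔ sym sym) (j ≟ i) (i ≟ j))))
  (∑-𝟙-≟ˡ i)

-- Adding the single index equal to `i` makes every term 1, and cancelling it avoids subtraction.
-- With `i` the original copy, this counts the replicas.
∑-𝟙-≢ : ∀ {n} (i : Fin (suc n)) → ∑[ j < suc n ] 𝟙 (¬? (j ≟ i)) ≡ n
∑-𝟙-≢ {n} i = ℕP.+-cancelʳ-≡ 1 _ n (begin
  ∑[ j < suc n ] 𝟙 (¬? (j ≟ i)) +ℕ 1
    ≡⟨ cong (sum (λ j → 𝟙 (¬? (j ≟ i))) +ℕ_) (∑-𝟙-≟ʳ i) ⟨
  ∑[ j < suc n ] 𝟙 (¬? (j ≟ i)) +ℕ ∑[ j < suc n ] 𝟙 (j ≟ i)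
    ≡⟨ ∑-distrib-+ (λ j → 𝟙 (¬? (j ≟ i))) (λ j → 𝟙 (j ≟ i)) ⟨
  ∑[ j < suc n ] (𝟙 (¬? (j ≟ i)) +ℕ 𝟙 (j ≟ i))
    ≡⟨ sum-cong-≗ {suc n} (λ j → 𝟙-¬ (j ≟ i)) ⟩
  ∑[ _ < suc n ] 1
    ≡⟨ sum-const (suc n) 1 ⟩
  suc n *ℕ 1
    ≡⟨ trans (ℕP.*-identityʳ (suc n)) (ℕP.+-comm 1 n) ⟩
  n +ℕ 1 ∎)
  where open ≡-Reasoning

-- Bottom nodes and degree sum of one join.

degreeSum : HubGraph → ℕ
degreeSum H = sum (HubGraph.degree H)

bottomCount : HubGraph → ℕ
bottomCount H = ∑[ v < HubGraph.order H ] 𝟙 (HubGraph.Bottom? H v)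

module _ (m : ℕ) (H : HubGraph) where
  open HubGraph H
  open Join (suc m) H

  private
    V : ℕ
    V = suc m *ℕ order

  bottomCount-join : bottomCount join ≡ m *ℕ bottomCount H
  bottomCount-join = begin
    ∑[ x < V ] 𝟙 (bottomOfReplica? (vertex x))
      ≡⟨ sum-cong-≗ {V} (λ x → 𝟙-× (¬? (proj₁ (vertex x) ≟ original)) (Bottom? (proj₂ (vertex x)))) ⟩
    ∑[ x < V ] (𝟙 (¬? (proj₁ (vertex x) ≟ original)) *ℕ 𝟙 (Bottom? (proj₂ (vertex x))))
      ≡⟨ sum-remQuot-* (suc m) (λ j → 𝟙 (¬? (j ≟ original))) (λ v → 𝟙 (Bottom? v)) ⟩
    ∑[ j < suc m ] 𝟙 (¬? (j ≟ original)) *ℕ bottomCount H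
      ≡⟨ cong (_*ℕ bottomCount H) (∑-𝟙-≢ original) ⟩
    m *ℕ bottomCount H ∎
    where open ≡-Reasoning

  ∑∑-sameCopy : ∑[ x < V ] ∑[ y < V ] 𝟙 (sameCopy? (vertex x) (vertex y)) ≡ suc m *ℕ degreeSum H
  ∑∑-sameCopy = begin
    ∑[ x < V ] ∑[ y < V ] 𝟙 (sameCopy? (vertex x) (vertex y))
      ≡⟨ sum-cong-≗ {V} (λ x → row (vertex x)) ⟩
    -- The factor 1 is the number of copies equal to `i`; keeping it gives the summand the product
    -- form that `sum-remQuot-*` expects.
    ∑[ x < V ] (1 *ℕ degree (proj₂ (vertex x)))
      ≡⟨ sum-remQuot-* (suc m) (λ _ → 1) degree ⟩
    ∑[ _ < suc m ] 1 *ℕ degreeSum H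
      ≡⟨ cong (_*ℕ degreeSum H) (trans (sum-const (suc m) 1) (ℕP.*-identityʳ (suc m))) ⟩
    suc m *ℕ degreeSum H ∎
    where
    open ≡-Reasoning
    row : ∀ p → ∑[ y < V ] 𝟙 (sameCopy? p (vertex y)) ≡ 1 *ℕ degree (proj₂ p)
    row (i , u) = begin
      ∑[ y < V ] 𝟙 (sameCopy? (i , u) (vertex y))
        ≡⟨ sum-cong-≗ {V} (λ y → 𝟙-× (i ≟ proj₁ (vertex y)) (u ~? proj₂ (vertex y))) ⟩
      ∑[ y < V ] (𝟙 (i ≟ proj₁ (vertex y)) *ℕ 𝟙 (u ~? proj₂ (vertex y)))
        ≡⟨ sum-remQuot-* (suc m) (λ j → 𝟙 (i ≟ j)) (λ v → 𝟙 (u ~? v)) ⟩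
      ∑[ j < suc m ] 𝟙 (i ≟ j) *ℕ ∑[ v < order ] 𝟙 (u ~? v)
        ≡⟨ cong₂ _*ℕ_ (∑-𝟙-≟ˡ i) (sym (∣tabulate∣ (λ v → does (u ~? v)))) ⟩
      1 *ℕ degree u ∎

  -- Only the row of the hub is nonzero, and that row counts all bottom nodes of the join, since
  -- these are exactly the endpoints of the new edges.
  ∑∑-hubToBottom : ∑[ x < V ] ∑[ y < V ] 𝟙 (hubToBottom? (vertex x) (vertex y)) ≡ bottomCount join
  ∑∑-hubToBottom = begin
    ∑[ x < V ] ∑[ y < V ] 𝟙 (hubToBottom? (vertex x) (vertex y))
      ≡⟨ sum-cong-≗ {V} (λ x → row (vertex x)) ⟩
    ∑[ x < V ] (𝟙 (proj₁ (vertex x) ≟ original) *ℕ 𝟙 (proj₂ (vertex x) ≟ root) *ℕ bottomCount join)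
      ≡⟨ *-distribʳ-sum (bottomCount join)
           (λ x → 𝟙 (proj₁ (vertex x) ≟ original) *ℕ 𝟙 (proj₂ (vertex x) ≟ root)) ⟨
    ∑[ x < V ] (𝟙 (proj₁ (vertex x) ≟ original) *ℕ 𝟙 (proj₂ (vertex x) ≟ root)) *ℕ bottomCount join
      ≡⟨ cong (_*ℕ bottomCount join) (sum-remQuot-* (suc m) (λ i → 𝟙 (i ≟ original)) (λ u → 𝟙 (u ≟ root))) ⟩
    ∑[ i < suc m ] 𝟙 (i ≟ original) *ℕ ∑[ u < order ] 𝟙 (u ≟ root) *ℕ bottomCount join
      ≡⟨ cong (_*ℕ bottomCount join) (cong₂ _*ℕ_ (∑-𝟙-≟ʳ original) (∑-𝟙-≟ʳ root)) ⟩
    1 *ℕ bottomCount join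
      ≡⟨ ℕP.*-identityˡ (bottomCount join) ⟩
    bottomCount join ∎
    where
    open ≡-Reasoning
    row : ∀ p → ∑[ y < V ] 𝟙 (hubToBottom? p (vertex y))
                ≡ 𝟙 (proj₁ p ≟ original) *ℕ 𝟙 (proj₂ p ≟ root) *ℕ bottomCount join
    row (i , u) = begin
      ∑[ y < V ] 𝟙 (hubToBottom? (i , u) (vertex y))
        ≡⟨ sum-cong-≗ {V} (λ y → 𝟙-× hub? (bottomOfReplica? (vertex y))) ⟩
      ∑[ y < V ] (𝟙 hub? *ℕ 𝟙 (bottomOfReplica? (vertex y)))
        ≡⟨ *-distribˡ-sum (𝟙 hub?) (λ y → 𝟙 (bottomOfReplica? (vertex y))) ⟨
      𝟙 hub? *ℕ bottomCount join
        ≡⟨ cong (_*ℕ bottomCount join) (𝟙-× (i ≟ original) (u ≟ root)) ⟩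
      𝟙 (i ≟ original) *ℕ 𝟙 (u ≟ root) *ℕ bottomCount join ∎
      where hub? = (i ≟ original) ×-dec (u ≟ root)

  -- The three kinds of adjacency exclude each other: a new edge starts in the original copy and
  -- ends in a replica, so it neither stays inside one copy nor runs in both directions. Hence the
  -- indicators simply add.
  𝟙-adjacent : ∀ p q → 𝟙 (adjacent? p q)
                       ≡ 𝟙 (sameCopy? p q) +ℕ (𝟙 (hubToBottom? p q) +ℕ 𝟙 (hubToBottom? q p))
  𝟙-adjacent p q = trans
    (𝟙-⊎ (sameCopy? p q) (hubToBottom? p q ⊎-dec hubToBottom? q p)
      λ { (refl , _) (inj₁ ((i≡o , _) , (i≢o , _))) → i≢o i≡o
        ; (refl , _) (inj₂ ((i≡o , _) , (i≢o , _))) → i≢o i≡o })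
    (cong (𝟙 (sameCopy? p q) +ℕ_)
      (𝟙-⊎ (hubToBottom? p q) (hubToBottom? q p)
        λ { ((i≡o , _) , _) (_ , (i≢o , _)) → i≢o i≡o }))

  degreeSum-join : degreeSum join ≡ suc m *ℕ degreeSum H +ℕ (bottomCount join +ℕ bottomCount join)
  degreeSum-join = begin
    ∑[ x < V ] HubGraph.degree join x
      ≡⟨ sum-cong-≗ {V} (λ x → ∣tabulate∣ (λ y → does (adjacent? (vertex x) (vertex y)))) ⟩
    ∑[ x < V ] ∑[ y < V ] 𝟙 (adjacent? (vertex x) (vertex y))
      ≡⟨ sum-cong-≗ {V} (λ x → sum-cong-≗ {V} (λ y → 𝟙-adjacent (vertex x) (vertex y))) ⟩
    ∑[ x < V ] ∑[ y < V ] (s x y +ℕ (h x y +ℕ h y x))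
      ≡⟨ ∑∑-distrib-+ s (λ x y → h x y +ℕ h y x) ⟩
    ∑[ x < V ] ∑[ y < V ] s x y +ℕ ∑[ x < V ] ∑[ y < V ] (h x y +ℕ h y x)
      ≡⟨ cong (∑∑ s +ℕ_) (∑∑-distrib-+ h (λ x y → h y x)) ⟩
    ∑[ x < V ] ∑[ y < V ] s x y +ℕ (∑[ x < V ] ∑[ y < V ] h x y +ℕ ∑[ x < V ] ∑[ y < V ] h y x)
      -- Exchanging the two sums turns the transposed hub term into the direct one, so each new edge
      -- contributes 2 to the degree sum.
      ≡⟨ cong (λ k → ∑∑ s +ℕ (∑∑ h +ℕ k)) (∑-comm (λ x y → h y x)) ⟩
    ∑[ x < V ] ∑[ y < V ] s x y +ℕ (∑[ x < V ] ∑[ y < V ] h x y +ℕ ∑[ x < V ] ∑[ y < V ] h x y)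
      ≡⟨ cong₂ (λ k l → k +ℕ (l +ℕ l)) ∑∑-sameCopy ∑∑-hubToBottom ⟩
    suc m *ℕ degreeSum H +ℕ (bottomCount join +ℕ bottomCount join) ∎
    where
    open ≡-Reasoning
    s h : Fin V → Fin V → ℕ
    s x y = 𝟙 (sameCopy? (vertex x) (vertex y))
    h x y = 𝟙 (hubToBottom? (vertex x) (vertex y))
    ∑∑ : (Fin V → Fin V → ℕ) → ℕ
    ∑∑ f = ∑[ x < V ] ∑[ y < V ] f x y
    ∑∑-distrib-+ : ∀ f g → ∑∑ (λ x y → f x y +ℕ g x y) ≡ ∑∑ f +ℕ ∑∑ g
    ∑∑-distrib-+ f g = trans
      (sum-cong-≗ {V} (λ x → ∑-distrib-+ (f x) (g x)))
      (∑-distrib-+ (λ x → sum (f x)) (λ x → sum (g x)))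

-- Closed forms along the recursion, with `z = suc m`.

order-G : ∀ m t → HubGraph.order (G (suc m) t) ≡ 3 *ℕ suc m ℕ.^ t
order-G m ℕ.zero  = refl
order-G m (suc t) = trans (cong (suc m *ℕ_) (order-G m t)) (swap (suc m) (suc m ℕ.^ t))
  where
  swap : ∀ a b → a *ℕ (3 *ℕ b) ≡ 3 *ℕ (a *ℕ b)
  swap = solve-∀

bottomCount-G : ∀ m t → bottomCount (G (suc m) t) ≡ 2 *ℕ m ℕ.^ t
bottomCount-G m ℕ.zero  = refl
bottomCount-G m (suc t) = trans (bottomCount-join m (G (suc m) t))
  (trans (cong (m *ℕ_) (bottomCount-G m t)) (swap m (m ℕ.^ t)))
  where
  swap : ∀ a b → a *ℕ (2 *ℕ b) ≡ 2 *ℕ (a *ℕ b)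
  swap = solve-∀

-- The correction term stands on the left to stay within ℕ. It is chosen so that a join multiplies
-- the whole left side by `suc m`: the new edges add `4 m^(t+1)`, and
-- `4 m^(t+1) + 4 m^(t+2) = (m+1) 4 m^(t+1)`.
degreeSum-G : ∀ m t → degreeSum (G (suc m) t) +ℕ 4 *ℕ (m *ℕ m ℕ.^ t)
                      ≡ (4 *ℕ suc m +ℕ 2) *ℕ suc m ℕ.^ t
degreeSum-G m ℕ.zero  = base m
  where
  base : ∀ m → 6 +ℕ 4 *ℕ (m *ℕ 1) ≡ (4 *ℕ suc m +ℕ 2) *ℕ 1
  base = solve-∀
degreeSum-G m (suc t) = begin
  degreeSum (G (suc m) (suc t)) +ℕ 4 *ℕ (m *ℕ (m *ℕ P))
    ≡⟨ cong (_+ℕ 4 *ℕ (m *ℕ (m *ℕ P))) (degreeSum-join m (G (suc m) t)) ⟩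
  suc m *ℕ S +ℕ (bottomCount (G (suc m) (suc t)) +ℕ bottomCount (G (suc m) (suc t))) +ℕ 4 *ℕ (m *ℕ (m *ℕ P))
    ≡⟨ cong (λ b → suc m *ℕ S +ℕ (b +ℕ b) +ℕ 4 *ℕ (m *ℕ (m *ℕ P))) (bottomCount-G m (suc t)) ⟩
  suc m *ℕ S +ℕ (2 *ℕ (m *ℕ P) +ℕ 2 *ℕ (m *ℕ P)) +ℕ 4 *ℕ (m *ℕ (m *ℕ P))
    ≡⟨ collect m S P ⟩
  suc m *ℕ (S +ℕ 4 *ℕ (m *ℕ P))
    ≡⟨ cong (suc m *ℕ_) (degreeSum-G m t) ⟩
  suc m *ℕ ((4 *ℕ suc m +ℕ 2) *ℕ Q)
    ≡⟨ swap (suc m) (4 *ℕ suc m +ℕ 2) Q ⟩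
  (4 *ℕ suc m +ℕ 2) *ℕ (suc m *ℕ Q) ∎
  where
  open ≡-Reasoning
  S P Q : ℕ
  S = degreeSum (G (suc m) t)
  P = m ℕ.^ t
  Q = suc m ℕ.^ t
  collect : ∀ m S P → suc m *ℕ S +ℕ (2 *ℕ (m *ℕ P) +ℕ 2 *ℕ (m *ℕ P)) +ℕ 4 *ℕ (m *ℕ (m *ℕ P))
                      ≡ suc m *ℕ (S +ℕ 4 *ℕ (m *ℕ P))
  collect = solve-∀
  swap : ∀ a b c → a *ℕ (b *ℕ c) ≡ b *ℕ (a *ℕ c)
  swap = solve-∀

-- Natural numbers and fractions inside ℚ.

fromℚᵘ-homo-+ : ∀ p q → fromℚᵘ (p ℚᵘ.+ q) ≡ fromℚᵘ p + fromℚᵘ q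
fromℚᵘ-homo-+ p q = ℚP.toℚᵘ-injective (begin
  toℚᵘ (fromℚᵘ (p ℚᵘ.+ q))                  ≈⟨ ℚP.toℚᵘ-fromℚᵘ (p ℚᵘ.+ q) ⟩
  p ℚᵘ.+ q                                  ≈⟨ ℚᵘP.+-cong (ℚP.toℚᵘ-fromℚᵘ p) (ℚP.toℚᵘ-fromℚᵘ q) ⟨
  toℚᵘ (fromℚᵘ p) ℚᵘ.+ toℚᵘ (fromℚᵘ q)      ≈⟨ ℚP.toℚᵘ-homo-+ (fromℚᵘ p) (fromℚᵘ q) ⟨
  toℚᵘ (fromℚᵘ p + fromℚᵘ q)                ∎)
  where open ℚᵘP.≃-Reasoning

fromℚᵘ-homo-* : ∀ p q → fromℚᵘ (p ℚᵘ.* q) ≡ fromℚᵘ p * fromℚᵘ q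
fromℚᵘ-homo-* p q = ℚP.toℚᵘ-injective (begin
  toℚᵘ (fromℚᵘ (p ℚᵘ.* q))                  ≈⟨ ℚP.toℚᵘ-fromℚᵘ (p ℚᵘ.* q) ⟩
  p ℚᵘ.* q                                  ≈⟨ ℚᵘP.*-cong (ℚP.toℚᵘ-fromℚᵘ p) (ℚP.toℚᵘ-fromℚᵘ q) ⟨
  toℚᵘ (fromℚᵘ p) ℚᵘ.* toℚᵘ (fromℚᵘ q)      ≈⟨ ℚP.toℚᵘ-homo-* (fromℚᵘ p) (fromℚᵘ q) ⟨
  toℚᵘ (fromℚᵘ p * fromℚᵘ q)                ∎)
  where open ℚᵘP.≃-Reasoning

κ : ℕ → ℚ
κ n = + n / 1

κ-homo-+ : ∀ m n → κ (m +ℕ n) ≡ κ m + κ n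
κ-homo-+ m n = trans
  -- The unnormalised sum has numerator `m * 1 + n * 1`, so the factors 1 are inserted first.
  (cong₂ (λ i j → (i ℤ.+ j) / 1) (sym (ℤP.*-identityʳ (+ m))) (sym (ℤP.*-identityʳ (+ n))))
  (fromℚᵘ-homo-+ (ℚᵘ.mkℚᵘ (+ m) 0) (ℚᵘ.mkℚᵘ (+ n) 0))

κ-homo-* : ∀ m n → κ (m *ℕ n) ≡ κ m * κ n
κ-homo-* m n = trans (cong (_/ 1) (ℤP.pos-* m n))
  (fromℚᵘ-homo-* (ℚᵘ.mkℚᵘ (+ m) 0) (ℚᵘ.mkℚᵘ (+ n) 0))

-- Normalisation in ℚ blocks computation on open terms, so the product is formed in ℚᵘ, where
-- equality is cross multiplication. This is the tool for clearing denominators below.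
/-*-cancel : ∀ i n .{{_ : NonZero n}} → (i / n) * κ n ≡ i / 1
/-*-cancel i (suc k) = trans
  (sym (fromℚᵘ-homo-* (ℚᵘ.mkℚᵘ i k) (ℚᵘ.mkℚᵘ (+ suc k) 0)))
  (ℚP.fromℚᵘ-cong
    {ℚᵘ.mkℚᵘ i k ℚᵘ.* ℚᵘ.mkℚᵘ (+ suc k) 0} {ℚᵘ.mkℚᵘ i 0}
    (ℚᵘ.*≡* (trans (ℤP.*-identityʳ (i ℤ.* + suc k))
    (cong (i ℤ.*_) (sym (cong +_ (ℕP.*-identityʳ (suc k))))))))

κ-nonNeg : ∀ n → NonNegative (κ n)
κ-nonNeg n = ℚP.normalize-nonNeg n 1

κ-pos : ∀ n .{{_ : NonZero n}} → Positive (κ n)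
κ-pos n = ℚP.normalize-pos n 1

κ-mono-≤ : ∀ {m n} → m ℕ.≤ n → κ m ≤ κ n
κ-mono-≤ {m} {n} m≤n = subst (κ m ≤_) (trans (sym (κ-homo-+ m _)) (cong κ (ℕP.m+[n∸m]≡n m≤n)))
  (subst (_≤ κ m + κ (n ℕ.∸ m)) (ℚP.+-identityʳ (κ m))
    (ℚP.+-monoʳ-≤ (κ m) (ℚP.nonNegative⁻¹ _ {{κ-nonNeg (n ℕ.∸ m)}})))

κ-<-suc : ∀ n → κ n < κ (suc n)
κ-<-suc n = subst₂ _<_ (ℚP.+-identityˡ (κ n)) (sym (κ-homo-+ 1 n))
  (ℚP.+-monoˡ-< (κ n) (ℚP.positive⁻¹ 1ℚ))

-- The Archimedean property and a Bernoulli-type bound.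

archimedean : ∀ p ε .{{_ : Positive ε}} → ∃[ N ] p < ε * κ N
-- A positive `ε` has numerator `suc a`. The factor `↧ₙ ε` of the witness cancels the denominator of
-- `ε`, leaving `suc a * suc n` with `n` the absolute numerator of `p`; the `suc` on `n` makes the
-- inequality strict.
archimedean p ε@(mkℚ (+ suc a) d-1 _) = ↧ₙ ε *ℕ suc n , (begin-strict
  p                          ≤⟨ p≤κn ⟩
  κ n                        <⟨ κ-<-suc n ⟩
  κ (suc n)                  ≤⟨ κ-mono-≤ (ℕP.m≤n*m (suc n) (suc a)) ⟩
  κ (suc a *ℕ suc n)         ≡⟨ κ-homo-* (suc a) (suc n) ⟩
  κ (suc a) * κ (suc n)      ≡⟨ cong (_* κ (suc n)) (/-*-cancel (↥ ε) (↧ₙ ε)) ⟨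
  (↥ ε / ↧ₙ ε) * κ (↧ₙ ε) * κ (suc n)
                             ≡⟨ cong (λ q → q * κ (↧ₙ ε) * κ (suc n)) (ℚP.↥p/↧p≡p ε) ⟩
  ε * κ (↧ₙ ε) * κ (suc n)   ≡⟨ ℚP.*-assoc ε (κ (↧ₙ ε)) (κ (suc n)) ⟩
  ε * (κ (↧ₙ ε) * κ (suc n)) ≡⟨ cong (ε *_) (κ-homo-* (↧ₙ ε) (suc n)) ⟨
  ε * κ (↧ₙ ε *ℕ suc n)      ∎)
  where
  open ℚP.≤-Reasoning
  n : ℕ
  n = ℤ.∣ ↥ p ∣
  i≤∣i∣ : ∀ i → i ℤ.≤ + ℤ.∣ i ∣
  i≤∣i∣ (+ _)      = ℤP.≤-refl
  i≤∣i∣ ℤ.-[1+ _ ] = ℤ.-≤+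
  p≤κn : p ≤ κ n
  -- After multiplication by the denominator the claim is `↥ p ≤ n * ↧ₙ p`, which holds because the
  -- denominator is at least 1.
  p≤κn = ℚP.*-cancelʳ-≤-pos (κ (↧ₙ p)) {{κ-pos (↧ₙ p)}} (begin
    p * κ (↧ₙ p)              ≡⟨ cong (_* κ (↧ₙ p)) (ℚP.↥p/↧p≡p p) ⟨
    (↥ p / ↧ₙ p) * κ (↧ₙ p)   ≡⟨ /-*-cancel (↥ p) (↧ₙ p) ⟩
    ↥ p / 1                   ≤⟨ ι-mono (i≤∣i∣ (↥ p)) ⟩
    κ n                       ≤⟨ κ-mono-≤ (ℕP.m≤m*n n (↧ₙ p)) ⟩
    κ (n *ℕ ↧ₙ p)             ≡⟨ κ-homo-* n (↧ₙ p) ⟩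
    κ n * κ (↧ₙ p)            ∎)
    where
    ι-mono : ∀ {i j} → i ℤ.≤ j → i / 1 ≤ j / 1
    ι-mono {i} {j} i≤j = ℚP.toℚᵘ-cancel-≤
      (ℚᵘP.≤-respʳ-≃ (ℚᵘP.≃-sym (ℚP.toℚᵘ-fromℚᵘ (ℚᵘ.mkℚᵘ j 0)))
        (ℚᵘP.≤-respˡ-≃ (ℚᵘP.≃-sym (ℚP.toℚᵘ-fromℚᵘ (ℚᵘ.mkℚᵘ i 0)))
          (ℚᵘ.*≤* (ℤP.*-monoʳ-≤-nonNeg (+ 1) i≤j))))

-- The bound on `(m/(m+1))^t` with denominators cleared. The induction step rests on
-- `m (m+t+1) + t = (m+1) (m+t)`: the slack `P *ℕ t` is what completes the product.
m^t*[m+t]≤m*[1+m]^t : ∀ m t → m ℕ.^ t *ℕ (m +ℕ t) ℕ.≤ m *ℕ suc m ℕ.^ t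
m^t*[m+t]≤m*[1+m]^t m ℕ.zero = ℕP.≤-reflexive (base m)
  where
  base : ∀ m → 1 *ℕ (m +ℕ 0) ≡ m *ℕ 1
  base = solve-∀
m^t*[m+t]≤m*[1+m]^t m (suc t) = begin
  m *ℕ P *ℕ (m +ℕ suc t)                   ≤⟨ ℕP.m≤m+n _ (P *ℕ t) ⟩
  m *ℕ P *ℕ (m +ℕ suc t) +ℕ P *ℕ t         ≡⟨ factor m t P ⟩
  suc m *ℕ (P *ℕ (m +ℕ t))                 ≤⟨ ℕP.*-monoʳ-≤ (suc m) (m^t*[m+t]≤m*[1+m]^t m t) ⟩
  suc m *ℕ (m *ℕ Q)                        ≡⟨ swap (suc m) m Q ⟩
  m *ℕ (suc m *ℕ Q)                        ∎
  where
  open ℕP.≤-Reasoning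
  P Q : ℕ
  P = m ℕ.^ t
  Q = suc m ℕ.^ t
  factor : ∀ m t P → m *ℕ P *ℕ (m +ℕ suc t) +ℕ P *ℕ t ≡ suc m *ℕ (P *ℕ (m +ℕ t))
  factor = solve-∀
  swap : ∀ a b c → a *ℕ (b *ℕ c) ≡ b *ℕ (a *ℕ c)
  swap = solve-∀

-- The average degree and its limit.

module _ (m : ℕ) where

  -- The numerator keeps the shape `z - 1` of the theorem and reduces to `+ m`, so it fits both the
  -- final statement and the lemmas about `m`.
  ratio : ℚ
  ratio = (+ suc m ℤ.- + 1) / suc m

  limit : ℚ
  limit = + (4 *ℕ suc m +ℕ 2) / 3

  ratio^-* : ∀ t → ratio ^ t * κ (suc m ℕ.^ t) ≡ κ (m ℕ.^ t)
  ratio^-* ℕ.zero  = refl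
  ratio^-* (suc t) = begin
    ratio * ratio ^ t * κ (suc m *ℕ suc m ℕ.^ t)
      ≡⟨ cong (ratio * ratio ^ t *_) (κ-homo-* (suc m) (suc m ℕ.^ t)) ⟩
    ratio * ratio ^ t * (κ (suc m) * κ (suc m ℕ.^ t))
      ≡⟨ solve 4 (λ r R k Z → r :* R :* (k :* Z) := (r :* k) :* (R :* Z)) refl
           ratio (ratio ^ t) (κ (suc m)) (κ (suc m ℕ.^ t)) ⟩
    ratio * κ (suc m) * (ratio ^ t * κ (suc m ℕ.^ t))
      ≡⟨ cong₂ _*_ (/-*-cancel (+ suc m ℤ.- + 1) (suc m)) (ratio^-* t) ⟩
    κ m * κ (m ℕ.^ t)
      ≡⟨ κ-homo-* m (m ℕ.^ t) ⟨
    κ (m *ℕ m ℕ.^ t) ∎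
    where
    open ≡-Reasoning
    open ℚ-Solver.+-*-Solver

  -- Multiplication by `(m+1)^t` reduces this to the Bernoulli-type inequality between natural
  -- numbers.
  ratio^-bound : ∀ t → ratio ^ t * κ (m +ℕ t) ≤ κ m
  ratio^-bound t = ℚP.*-cancelʳ-≤-pos (κ Q) {{κ-pos Q {{ℕP.m^n≢0 (suc m) t}}}} (begin
    ratio ^ t * κ (m +ℕ t) * κ Q
      ≡⟨ solve 3 (λ R k Z → R :* k :* Z := R :* Z :* k) refl (ratio ^ t) (κ (m +ℕ t)) (κ Q) ⟩
    ratio ^ t * κ Q * κ (m +ℕ t)       ≡⟨ cong (_* κ (m +ℕ t)) (ratio^-* t) ⟩
    κ (m ℕ.^ t) * κ (m +ℕ t)           ≡⟨ κ-homo-* (m ℕ.^ t) (m +ℕ t) ⟨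
    κ (m ℕ.^ t *ℕ (m +ℕ t))            ≤⟨ κ-mono-≤ (m^t*[m+t]≤m*[1+m]^t m t) ⟩
    κ (m *ℕ Q)                         ≡⟨ κ-homo-* m Q ⟩
    κ m * κ Q                          ∎)
    where
    open ℚP.≤-Reasoning
    open ℚ-Solver.+-*-Solver
    Q : ℕ
    Q = suc m ℕ.^ t

  1-κ[1+m] : 1ℚ - κ (suc m) ≡ - κ m
  1-κ[1+m] = trans (cong (λ q → 1ℚ - q) (κ-homo-+ 1 m))
    (solve 1 (λ M → con 1ℚ :- (con 1ℚ :+ M) := :- M) refl (κ m))
    where open ℚ-Solver.+-*-Solver

  -- Both sides are compared after multiplication by the order `3 *ℕ Q`, which turns the average
  -- into the degree sum.
  averageDegree-G : ∀ t → HubGraph.averageDegree (G (suc m) t)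
                          ≡ (+ 4 / 3) * (1ℚ - κ (suc m)) * ratio ^ t + limit
  averageDegree-G t = *-cancelʳ-pos (κ (3 *ℕ Q))
    {{κ-pos (3 *ℕ Q) {{ℕP.m*n≢0 3 Q {{_}} {{ℕP.m^n≢0 (suc m) t}}}}}} (begin
    A * κ (3 *ℕ Q)
      ≡⟨ cong (λ n → A * κ n) (order-G m t) ⟨
    A * κ order
      ≡⟨ /-*-cancel (+ degreeSum (G (suc m) t)) order {{nonZeroIndex root}} ⟩
    S
      -- The correction term is added and subtracted to bring in the left side of `degreeSum-G`.
      ≡⟨ solve 2 (λ S x → S := S :+ x :- x) refl S (κ (4 *ℕ (m *ℕ P))) ⟩
    S + κ (4 *ℕ (m *ℕ P)) - κ (4 *ℕ (m *ℕ P))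
      ≡⟨ cong (_- κ (4 *ℕ (m *ℕ P))) (κ-homo-+ (degreeSum (G (suc m) t)) (4 *ℕ (m *ℕ P))) ⟨
    κ (degreeSum (G (suc m) t) +ℕ 4 *ℕ (m *ℕ P)) - κ (4 *ℕ (m *ℕ P))
      ≡⟨ cong (λ n → κ n - κ (4 *ℕ (m *ℕ P))) (degreeSum-G m t) ⟩
    κ (c *ℕ Q) - κ (4 *ℕ (m *ℕ P))
      ≡⟨ cong₂ _-_
           (trans (κ-homo-* c Q) (cong (_* κ Q) (sym (/-*-cancel (+ c) 3))))
           (trans (κ-homo-* 4 (m *ℕ P)) (cong (κ 4 *_)
             (trans (κ-homo-* m P) (cong (κ m *_) (sym (ratio^-* t)))))) ⟩
    limit * κ 3 * κ Q - κ 4 * (κ m * (ratio ^ t * κ Q))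
      -- The solver evaluates the closed coefficients, and `(4/3) * 3` meets `4`; `limit` stays an
      -- unknown.
      ≡⟨ solve 4 (λ L Z M R → L :* con (κ 3) :* Z :- con (κ 4) :* (M :* (R :* Z))
                           := (con (+ 4 / 3) :* (:- M) :* R :+ L) :* (con (κ 3) :* Z)) refl
           limit (κ Q) (κ m) (ratio ^ t) ⟩
    ((+ 4 / 3) * (- κ m) * ratio ^ t + limit) * (κ 3 * κ Q)
      ≡⟨ cong₂ (λ u v → ((+ 4 / 3) * u * ratio ^ t + limit) * v) 1-κ[1+m] (κ-homo-* 3 Q) ⟨
    ((+ 4 / 3) * (1ℚ - κ (suc m)) * ratio ^ t + limit) * κ (3 *ℕ Q) ∎)
    where
    open HubGraph (G (suc m) t) using (order; root)
    open ≡-Reasoning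
    open ℚ-Solver.+-*-Solver
    c P Q : ℕ
    c = 4 *ℕ suc m +ℕ 2
    P = m ℕ.^ t
    Q = suc m ℕ.^ t
    A S : ℚ
    A = HubGraph.averageDegree (G (suc m) t)
    S = κ (degreeSum (G (suc m) t))
    *-cancelʳ-pos : ∀ r .{{_ : Positive r}} {p q} → p * r ≡ q * r → p ≡ q
    *-cancelʳ-pos r eq = ℚP.≤-antisym
      (ℚP.*-cancelʳ-≤-pos r (ℚP.≤-reflexive eq))
      (ℚP.*-cancelʳ-≤-pos r (ℚP.≤-reflexive (sym eq)))

  ratio^-nonNeg : ∀ t → NonNegative (ratio ^ t)
  ratio^-nonNeg ℕ.zero  = _
  ratio^-nonNeg (suc t) =
    ℚP.nonNeg*nonNeg⇒nonNeg ratio {{ℚP.normalize-nonNeg m (suc m)}} (ratio ^ t) {{ratio^-nonNeg t}}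

  -- The factor `1 - z` equals `- m`, so the average lies at or below its limit and the absolute
  -- value only drops the sign.
  ∣averageDegree-limit∣ : ∀ t → abs (HubGraph.averageDegree (G (suc m) t) - limit)
                                ≡ (+ 4 / 3) * κ m * ratio ^ t
  ∣averageDegree-limit∣ t = begin
    abs (HubGraph.averageDegree (G (suc m) t) - limit)
      ≡⟨ cong (λ q → abs (q - limit)) (averageDegree-G t) ⟩
    abs ((+ 4 / 3) * (1ℚ - κ (suc m)) * ratio ^ t + limit - limit)
      ≡⟨ cong (λ u → abs ((+ 4 / 3) * u * ratio ^ t + limit - limit)) 1-κ[1+m] ⟩
    abs ((+ 4 / 3) * (- κ m) * ratio ^ t + limit - limit)
      ≡⟨ cong abs (solve 3 (λ M R L → con (+ 4 / 3) :* (:- M) :* R :+ L :- L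
                                   := :- (con (+ 4 / 3) :* M :* R)) refl (κ m) (ratio ^ t) limit) ⟩
    abs (- ((+ 4 / 3) * κ m * ratio ^ t))
      ≡⟨ ℚP.∣-p∣≡∣p∣ ((+ 4 / 3) * κ m * ratio ^ t) ⟩
    abs ((+ 4 / 3) * κ m * ratio ^ t)
      ≡⟨ ℚP.0≤p⇒∣p∣≡p (ℚP.nonNegative⁻¹ _ {{nonNeg}}) ⟩
    (+ 4 / 3) * κ m * ratio ^ t ∎
    where
    open ≡-Reasoning
    open ℚ-Solver.+-*-Solver
    nonNeg : NonNegative ((+ 4 / 3) * κ m * ratio ^ t)
    nonNeg = ℚP.nonNeg*nonNeg⇒nonNeg ((+ 4 / 3) * κ m)
      {{ℚP.nonNeg*nonNeg⇒nonNeg (+ 4 / 3) (κ m) {{κ-nonNeg m}}}} (ratio ^ t) {{ratio^-nonNeg t}}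

  -- Multiplied by `m + t`, the distance to the limit is at most `C * κ m`, a bound free of `t`.
  -- Hence any `N` with `C * κ m < ε * κ N` serves, as `N ≤ t ≤ m + t`.
  averageDegree-G-⟶ : (λ t → HubGraph.averageDegree (G (suc m) t)) ⟶ limit
  averageDegree-G-⟶ ε 0<ε = N , λ t N≤t →
    ℚP.*-cancelʳ-<-nonNeg (κ (m +ℕ t)) {{κ-nonNeg (m +ℕ t)}} (begin-strict
      abs (HubGraph.averageDegree (G (suc m) t) - limit) * κ (m +ℕ t)
        ≡⟨ cong (_* κ (m +ℕ t)) (∣averageDegree-limit∣ t) ⟩
      C * ratio ^ t * κ (m +ℕ t)
        ≡⟨ ℚP.*-assoc C (ratio ^ t) (κ (m +ℕ t)) ⟩
      C * (ratio ^ t * κ (m +ℕ t))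
        ≤⟨ ℚP.*-monoˡ-≤-nonNeg C {{C-nonNeg}} (ratio^-bound t) ⟩
      C * κ m
        <⟨ proj₂ (archimedean (C * κ m) ε {{ε-pos}}) ⟩
      ε * κ N
        ≤⟨ ℚP.*-monoˡ-≤-nonNeg ε {{ℚP.pos⇒nonNeg ε {{ε-pos}}}}
             (κ-mono-≤ (ℕP.≤-trans N≤t (ℕP.m≤n+m t m))) ⟩
      ε * κ (m +ℕ t) ∎)
    where
    open ℚP.≤-Reasoning
    C : ℚ
    C = (+ 4 / 3) * κ m
    C-nonNeg : NonNegative C
    C-nonNeg = ℚP.nonNeg*nonNeg⇒nonNeg (+ 4 / 3) (κ m) {{κ-nonNeg m}}
    ε-pos : Positive ε
    ε-pos = positive 0<ε
    N : ℕ
    N = proj₁ (archimedean (C * κ m) ε {{ε-pos}})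

theorem3p1 : ∀ (z : ℕ) .{{_ : NonZero z}} → z >ℕ 2 →
    (∀ (t : ℕ) → HubGraph.averageDegree (G z t)
    ≡ (+ 4 / 3) * (1ℚ - (+ z / 1)) * ((+ z ℤ.- + 1) / z) ^ t + (+ (4 *ℕ z +ℕ 2) / 3))
    × ((λ t → HubGraph.averageDegree (G z t)) ⟶ (+ (4 *ℕ z +ℕ 2) / 3))
theorem3p1 (suc m) _ = averageDegree-G m , averageDegree-G-⟶ m
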